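{- Let $\alpha,\beta\in[0,1]$. For $n\ge2$, the complete graph $K_n$ on $n$ vertices satisfies \[ \mathrm{Z}_{\alpha,\beta}(K_n)=\begin{cases} n-1 & \text{if } \beta\le(n-1)\alpha,\\ n & \text{if } (n-1)\alpha<\beta.\end{cases} \]
   Context: All graphs are finite and simple. Let $\alpha,\beta\in[0,1]$ be two constants, called the transmission proportion and the transmission threshold respectively, let $G$ be a graph and $B\subseteq V(G)$ a set of initially filled vertices. The transmission forcing process started from $B$ is defined as follows. Put $B_0=B$, $w_0(v)=1$ for $v\in B$ and $w_0(v)=0$ for $v\in V(G)\setminus B$. For $t\ge 1$, given the set $B_{t-1}$ of vertices filled at time $t-1$ and the weights $w_{t-1}$: for each unfilled vertex $u\in V(G)\setminus B_{t-1}$ let $\mathcal V_{t,u}$ be the set of all $v\in B_{t-1}$ such that $u$ is the only neighbor of $v$ in $V(G)\setminus B_{t-1}$ and $v\notin \mathcal V_{s,u'}$ for every $s<t$ and every $u'$ (each vertex transmits weight at most once); when $v\in\mathcal V_{t,u}$ we say $v$ forces $u$, written $v\to u$. Set $w_t(u)=w_{t-1}(u)+\sum_{v\in\mathcal V_{t,u}}\alpha\, w_{t-1}(v)$ for $u\in V(G)\setminus B_{t-1}$ and $w_t(u)=w_{t-1}(u)$ for $u\in B_{t-1}$. Then $B_t=B_{t-1}\cup\{u\in V(G)\setminus B_{t-1} : w_t(u)\ge\beta\}$. The set $B$ is an $(\alpha,\beta)$-transmission zero forcing set of $G$ if $B_t=V(G)$ for some $t\ge 0$, and the $(\alpha,\beta)$-transmission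 zero forcing number $\mathrm{Z}_{\alpha,\beta}(G)$ is the minimum cardinality of such a set.
   Formalization: The first case is stated for β > 0 only: for β = 0 the process as defined fills every vertex at time 1 even from the empty set, so Z_{α,0}(K_n) = 0 rather than n−1. -}

module Defs where

open import Level using (Level; _⊔_; 0ℓ) renaming (suc to lsuc)
open import Algebra.Bundles using (CommutativeRing)
open import Algebra.Core using (Op₁; Op₂)
open import Algebra.Structures using (IsCommutativeRing)
import Algebra.Definitions.RawMonoid as RawMonoidDefinitions
open import Data.Fin.Base using (Fin)
open import Data.Fin.Properties using (_≟_; any?; all?)
open import Data.Fin.Subset using (Subset; _∈_; _∉_; _∪_; ∣_∣; ⊤; ⊥)
open import Data.Fin.Subset.Properties using (_∈?_)
open import Data.Bool.Base using (if_then_else_)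
open import Data.Nat.Base as ℕ using (ℕ; zero; suc)
open import Data.Product.Base using (_×_; _,_; ∃-syntax)
open import Data.Vec.Base using (tabulate)
open import Relation.Binary.Core using (Rel)
open import Relation.Binary.Definitions using (Symmetric; Irreflexive)
  renaming (Decidable to Decidable₂)
open import Relation.Binary.PropositionalEquality using (_≡_; _≢_; ≢-sym)
open import Relation.Binary.Structures using (IsDecTotalOrder)
import Relation.Binary.Construct.NonStrictToStrict as NonStrictToStrict
open import Relation.Nullary.Decidable using (does; ¬?; _×-dec_; _→-dec_)
open import Relation.Nullary.Negation using (¬_; contradiction)
open import Relation.Unary using (Pred; Decidable)

private
  variable
    c ℓ₁ ℓ₂ p : Level
    n : ℕ

-- The library has no real numbers.  Constants and weights are taken from an
-- arbitrary linearly ordered field, of which ℝ (read classically, so that its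
-- order is decidable) is an instance.  Decidability is what makes the set of
-- filled vertices at each time a finite set that can be computed with.

record OrderedField c ℓ₁ ℓ₂ : Set (lsuc (c ⊔ ℓ₁ ⊔ ℓ₂)) where
  infix  8 -_
  infixl 7 _*_
  infixl 6 _+_
  infix  4 _≈_ _≤_
  field
    Carrier           : Set c
    _≈_               : Rel Carrier ℓ₁
    _≤_               : Rel Carrier ℓ₂
    _+_ _*_           : Op₂ Carrier
    -_                : Op₁ Carrier
    0# 1#             : Carrier
    isCommutativeRing : IsCommutativeRing _≈_ _+_ _*_ -_ 0# 1#
    isDecTotalOrder   : IsDecTotalOrder _≈_ _≤_
    1≉0               : ¬ (1# ≈ 0#)
    inverse           : ∀ x → ¬ (x ≈ 0#) → ∃[ y ] x * y ≈ 1#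
    +-monoʳ-≤         : ∀ x {y z} → y ≤ z → x + y ≤ x + z
    *-nonNeg          : ∀ {x y} → 0# ≤ x → 0# ≤ y → 0# ≤ x * y

  commutativeRing : CommutativeRing c ℓ₁
  commutativeRing = record { isCommutativeRing = isCommutativeRing }

  open CommutativeRing commutativeRing public
    using (+-rawMonoid; +-commutativeMonoid; semiring; ring)
  open IsDecTotalOrder isDecTotalOrder public using (_≤?_)
  open NonStrictToStrict _≈_ _≤_ public using (_<_)
  open RawMonoidDefinitions +-rawMonoid public
    using (sum) renaming (_×_ to _·_)

record Graph (n : ℕ) : Set₁ where
  infix 4 _~_ _~?_
  field
    _~_    : Rel (Fin n) 0ℓ
    sym    : Symmetric _~_
    irrefl : Irreflexive _≡_ _~_
    _~?_   : Decidable₂ _~_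

K : ∀ n → Graph n
K n = record
  { _~_    = _≢_
  ; sym    = ≢-sym
  ; irrefl = λ x≡y x≢y → contradiction x≡y x≢y
  ; _~?_   = λ x y → ¬? (x ≟ y)
  }

⟦_⟧ : {P : Pred (Fin n) p} → Decidable P → Subset n
⟦ P? ⟧ = tabulate (λ v → does (P? v))

module _ (G : Graph n) where
  open Graph G

  OnlyUnfilledNeighbour : Subset n → Fin n → Fin n → Set
  OnlyUnfilledNeighbour F v u =
    u ∉ F × v ~ u × (∀ x → x ∉ F → v ~ x → x ≡ u)

  onlyUnfilledNeighbour? : ∀ F → Decidable₂ (OnlyUnfilledNeighbour F)
  onlyUnfilledNeighbour? F v u =
    ¬? (u ∈? F) ×-dec v ~? u ×-dec
    all? (λ x → ¬? (x ∈? F) →-dec v ~? x →-dec x ≟ u)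

module Transmission (R : OrderedField c ℓ₁ ℓ₂) where
  open OrderedField R

  sum-over : ∀ {n} → Subset n → (Fin n → Carrier) → Carrier
  sum-over X f = sum (λ v → if does (v ∈? X) then f v else 0#)

  infix 7 sum-over
  syntax sum-over X (λ v → x) = ∑[ v ∈ X ] x

  module Process (α β : Carrier) (G : Graph n) (B₀ : Subset n) where

    -- A vertex need not have received any weight to meet the threshold 0: if
    -- β ≈ 0 then B 1 ≡ ⊤ whatever B₀ is, so the forcing number of every graph
    -- is 0 in that case.
    mutual
      B : ℕ → Subset n
      B zero    = B₀
      B (suc t) = B t ∪ ⟦ (λ u → ¬? (u ∈? B t) ×-dec β ≤? w (suc t) u) ⟧

      w : ℕ → Fin n → Carrier
      w zero    u = if does (u ∈? B₀) then 1# else 0#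
      w (suc t) u =
        if does (u ∈? B t) then w t u
        else w t u + (∑[ v ∈ 𝒱 (suc t) u ] (α * w t v))

      -- Times start at 1 here, so 𝒱 zero u is a dummy value.
      𝒱 : ℕ → Fin n → Subset n
      𝒱 zero    u = ⊥
      𝒱 (suc t) u = ⟦ (λ v → v ∈? B t
                       ×-dec onlyUnfilledNeighbour? G (B t) v u
                       ×-dec ¬? (v ∈? spent t)) ⟧

      -- spent t is the union of 𝒱 s u over all s ≤ t and all u.
      spent : ℕ → Subset n
      spent zero    = ⊥
      spent (suc t) = spent t ∪ ⟦ (λ v → any? (λ u → v ∈? 𝒱 (suc t) u)) ⟧

  IsTransmissionForcing : (α β : Carrier) → Graph n → Subset n → Set
  IsTransmissionForcing α β G B₀ = ∃[ t ] Process.B α β G B₀ t ≡ ⊤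

  -- k is the (α,β)-transmission zero forcing number of G; such a k is unique.
  IsZ : (α β : Carrier) → Graph n → ℕ → Set
  IsZ α β G k =
    (∃[ B ] IsTransmissionForcing α β G B × ∣ B ∣ ≡ k) ×
    (∀ B → IsTransmissionForcing α β G B → k ℕ.≤ ∣ B ∣)

{-# OPTIONS --safe #-}

-- Two distinct unfilled vertices of a complete graph are both adjacent to every
-- filled vertex, so they block every force and, when β > 0, stay unfilled
-- forever.  Hence a forcing set misses at most one vertex x.  If it misses x,
-- then at time 1 each of the other n − 1 vertices spends its only transmission
-- on x with weight α, and x receives nothing afterwards: x is ever filled iff
-- β ≤ (n − 1) α.

module Submission where

open import Defs
open import Data.Nat.Base as ℕ using (ℕ; zero; suc; _∸_)
import Data.Nat.Properties as ℕ
open import Data.Fin.Base using (Fin; zero; suc)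
open import Data.Fin.Properties using (_≟_; any?)
open import Data.Fin.Subset
  using (Subset; inside; outside; _∈_; _∉_; _⊆_; ∣_∣; ⊤; ∁; ⁅_⁆; Empty)
open import Data.Fin.Subset.Properties
open import Data.Product.Base using (_×_; _,_; proj₁; proj₂; ∃-syntax)
open import Data.Sum.Base using (inj₁; inj₂; [_,_])
open import Data.Vec.Base using ([]; _∷_; here; there)
open import Data.Vec.Properties using ([]=⇒lookup; lookup⇒[]=; lookup∘tabulate)
open import Algebra.Bundles using (CommutativeRing)
open import Function.Base using (_∘_; id)
open import Level using (Level)
open import Relation.Binary.PropositionalEquality as ≡ using (_≡_; _≢_)
open import Relation.Binary.Structures using (IsDecTotalOrder)
import Relation.Binary.Construct.NonStrictToStrict as NonStrictToStrict
open import Relation.Nullary.Decidable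
  using (yes; no; dec-true; dec-false; decidable-stable; ¬?; _×-dec_)
open import Relation.Nullary.Negation using (¬_; contradiction)
open import Relation.Unary using (Pred; Decidable)

private
  variable
    p : Level
    n : ℕ

module _ {P : Pred (Fin n) p} (P? : Decidable P) where

  ∈⟦⟧⁺ : ∀ {v} → P v → v ∈ ⟦ P? ⟧
  ∈⟦⟧⁺ {v} Pv = lookup⇒[]= v _ (≡.trans (lookup∘tabulate _ v) (dec-true (P? v) Pv))

  ∈⟦⟧⁻ : ∀ {v} → v ∈ ⟦ P? ⟧ → P v
  ∈⟦⟧⁻ {v} v∈ = decidable-stable (P? v) λ ¬Pv →
    contradiction (≡.trans (≡.sym (dec-false (P? v) ¬Pv))
                  (≡.trans (≡.sym (lookup∘tabulate _ v)) ([]=⇒lookup v∈))) λ ()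

∣∁⁅x⁆∣≡n∸1 : ∀ (x : Fin n) → ∣ ∁ ⁅ x ⁆ ∣ ≡ n ∸ 1
∣∁⁅x⁆∣≡n∸1 {n} x = ≡.trans (∣∁p∣≡n∸∣p∣ ⁅ x ⁆) (≡.cong (n ∸_) (∣⁅x⁆∣≡1 x))

∈∁⁅⁆⁺ : {v x : Fin n} → v ≢ x → v ∈ ∁ ⁅ x ⁆
∈∁⁅⁆⁺ = x∉p⇒x∈∁p ∘ x≢y⇒x∉⁅y⁆

∈∁⁅⁆⁻ : {v x : Fin n} → v ∈ ∁ ⁅ x ⁆ → v ≢ x
∈∁⁅⁆⁻ = x∉⁅y⁆⇒x≢y ∘ x∈∁p⇒x∉p

∈∧∉⇒≢ : {X : Subset n} {v x : Fin n} → v ∈ X → x ∉ X → v ≢ x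
∈∧∉⇒≢ v∈X x∉X ≡.refl = x∉X v∈X

∀∈⇒n≤∣p∣ : {X : Subset n} → (∀ v → v ∈ X) → n ℕ.≤ ∣ X ∣
∀∈⇒n≤∣p∣ {n} {X} all = ≡.subst (ℕ._≤ ∣ X ∣) (∣⊤∣≡n n) (p⊆q⇒∣p∣≤∣q∣ {p = ⊤} {X} λ {v} _ → all v)

module _ {c ℓ₁ ℓ₂} (R : OrderedField c ℓ₁ ℓ₂) where
  open OrderedField R
  open Transmission R
  open CommutativeRing commutativeRing
    using (refl; sym; trans; reflexive; +-cong; +-congˡ; +-identityˡ; +-identityʳ;
           *-congˡ; *-identityʳ)
  open IsDecTotalOrder isDecTotalOrder
    using (antisym; ≤-respˡ-≈; ≤-respʳ-≈) renaming (trans to ≤-trans; refl to ≤-refl)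
  open NonStrictToStrict _≈_ _≤_ using (<⇒≱; ≤-<-trans)

  -- This is what turns `(n ∸ 1) · α < β` into `0# < β`.
  0≤n·x : ∀ n {x} → 0# ≤ x → 0# ≤ n · x
  0≤n·x zero    0≤x = ≤-refl
  0≤n·x (suc n) 0≤x =
    ≤-trans (≤-respʳ-≈ (sym (+-identityʳ _)) 0≤x) (+-monoʳ-≤ _ (0≤n·x n 0≤x))

  sum-over-const : ∀ (X : Subset n) {f a} → (∀ v → v ∈ X → f v ≈ a) →
                   sum-over X f ≈ ∣ X ∣ · a
  sum-over-const []            f≈a = refl
  sum-over-const (inside  ∷ X) f≈a =
    +-cong (f≈a zero here) (sum-over-const X λ v → f≈a (suc v) ∘ there)
  sum-over-const (outside ∷ X) f≈a =
    trans (+-identityˡ _) (sum-over-const X λ v → f≈a (suc v) ∘ there)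

  sum-over-empty : ∀ {X : Subset n} f → Empty X → sum-over X f ≈ 0#
  sum-over-empty {n} {X} f empty =
    -- Over an empty set the constant is arbitrary; with `0#` the result `∣ X ∣ · 0#` computes to
    -- `0#` once `∣ X ∣` is 0.
    trans (sum-over-const X {a = 0#} λ v v∈X → contradiction (v , v∈X) empty)
          (reflexive (≡.cong (_· 0#) (≡.trans (≡.cong ∣_∣ (Empty-unique empty)) (∣⊥∣≡0 n))))

  module ProcessProperties (α β : Carrier) (G : Graph n) (B₀ : Subset n) where
    open Process α β G B₀

    private
      -- These three deciders name the anonymous ones inside `Process` and agree with them
      -- definitionally, so that the membership lemmas for `⟦_⟧` apply.
      newlyFilled? : ∀ t → Decidable (λ u → u ∉ B t × β ≤ w (suc t) u)
      newlyFilled? t u = ¬? (u ∈? B t) ×-dec β ≤? w (suc t) u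

      forces? : ∀ t u → Decidable (λ v →
        v ∈ B t × OnlyUnfilledNeighbour G (B t) v u × v ∉ spent t)
      forces? t u v = v ∈? B t ×-dec onlyUnfilledNeighbour? G (B t) v u
                      ×-dec ¬? (v ∈? spent t)

      forcesSome? : ∀ t → Decidable (λ v → ∃[ u ] v ∈ 𝒱 (suc t) u)
      forcesSome? t v = any? (λ u → v ∈? 𝒱 (suc t) u)

    w₀-filled : ∀ {u} → u ∈ B₀ → w 0 u ≡ 1#
    w₀-filled {u} u∈ rewrite dec-true (u ∈? B₀) u∈ = ≡.refl

    w₀-unfilled : ∀ {u} → u ∉ B₀ → w 0 u ≡ 0#
    w₀-unfilled {u} u∉ rewrite dec-false (u ∈? B₀) u∉ = ≡.refl

    w-unfilled : ∀ t {u} → u ∉ B t →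
                 w (suc t) u ≡ w t u + sum-over (𝒱 (suc t) u) (λ v → α * w t v)
    w-unfilled t {u} u∉ rewrite dec-false (u ∈? B t) u∉ = ≡.refl

    w-unforced : ∀ t {u} → u ∉ B t → Empty (𝒱 (suc t) u) → w (suc t) u ≈ w t u
    w-unforced t u∉ empty =
      trans (reflexive (w-unfilled t u∉))
            (trans (+-congˡ (sum-over-empty _ empty)) (+-identityʳ _))

    ∈B-suc⁺ : ∀ t {u} → u ∉ B t → β ≤ w (suc t) u → u ∈ B (suc t)
    ∈B-suc⁺ t u∉ β≤w = x∈p∪q⁺ (inj₂ (∈⟦⟧⁺ (newlyFilled? t) (u∉ , β≤w)))

    ∉B-suc : ∀ t {u} → u ∉ B t → ¬ β ≤ w (suc t) u → u ∉ B (suc t)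
    ∉B-suc t u∉ β≰w = [ u∉ , β≰w ∘ proj₂ ∘ ∈⟦⟧⁻ (newlyFilled? t) ] ∘ x∈p∪q⁻ (B t) _

    ∈𝒱⁺ : ∀ t u {v} → v ∈ B t → OnlyUnfilledNeighbour G (B t) v u → v ∉ spent t →
          v ∈ 𝒱 (suc t) u
    ∈𝒱⁺ t u v∈B only v∉spent = ∈⟦⟧⁺ (forces? t u) (v∈B , only , v∉spent)

    ∈𝒱⁻ : ∀ t u {v} → v ∈ 𝒱 (suc t) u →
          v ∈ B t × OnlyUnfilledNeighbour G (B t) v u × v ∉ spent t
    ∈𝒱⁻ t u = ∈⟦⟧⁻ (forces? t u)

    spent-mono : ∀ t → spent t ⊆ spent (suc t)
    spent-mono t v∈ = x∈p∪q⁺ (inj₁ v∈)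

    𝒱⊆spent : ∀ t u → 𝒱 (suc t) u ⊆ spent (suc t)
    𝒱⊆spent t u v∈ = x∈p∪q⁺ {p = spent t} (inj₂ (∈⟦⟧⁺ (forcesSome? t) (u , v∈)))

  module _ (α β : Carrier) (B₀ : Subset n) where
    open Process α β (K n) B₀
    open ProcessProperties α β (K n) B₀

    -- A filled `v` differs from the unfilled `y`, so it is adjacent to `y` in `K n`; if `x` were
    -- its only unfilled neighbour, `y` would equal `x`.
    𝒱-empty : ∀ t {x y} → x ≢ y → y ∉ B t → Empty (𝒱 (suc t) x)
    𝒱-empty t {x} {y} x≢y y∉ (v , v∈𝒱) with ∈𝒱⁻ t x v∈𝒱
    ... | v∈B , (_ , _ , unique) , _ = x≢y (≡.sym (unique y y∉ (∈∧∉⇒≢ v∈B y∉)))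

    module _ (0<β : 0# < β) {x y} (x≢y : x ≢ y) (x∉ : x ∉ B₀) (y∉ : y ∉ B₀) where

      private
        -- Filling compares accumulated weight with `β`, so the induction must carry the zero weight
        -- too. Each of the two vertices blocks all forces on the other.
        Idle : ℕ → Fin n → Set _
        Idle t u = u ∉ B t × w t u ≈ 0#

        idle-suc : ∀ t {u u′} → u ≢ u′ → Idle t u → Idle t u′ → Idle (suc t) u
        idle-suc t u≢u′ (u∉ , w≈0) (u′∉ , _) =
          ∉B-suc t u∉ (<⇒≱ antisym 0<β ∘ ≤-respʳ-≈ w′≈0) , w′≈0
          where w′≈0 = trans (w-unforced t u∉ (𝒱-empty t u≢u′ u′∉)) w≈0

        idle : ∀ t → Idle t x × Idle t y
        idle zero    = (x∉ , reflexive (w₀-unfilled x∉))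
                     , (y∉ , reflexive (w₀-unfilled y∉))
        idle (suc t) with idle t
        ... | ix , iy = idle-suc t x≢y ix iy , idle-suc t (x≢y ∘ ≡.sym) iy ix

      two-unfilled-stuck : ∀ t → x ∉ B t
      two-unfilled-stuck t = proj₁ (proj₁ (idle t))

    -- A second missed vertex would keep `x` unfilled at every time, including the time at which
    -- `B t` is `⊤`.
    forcing⇒misses≤1 : 0# < β → IsTransmissionForcing α β (K n) B₀ →
                       ∀ {x} → x ∉ B₀ → ∁ ⁅ x ⁆ ⊆ B₀
    forcing⇒misses≤1 0<β (t , Bt≡⊤) {x} x∉ {v} v∈ =
      decidable-stable (v ∈? B₀) λ v∉ →
        two-unfilled-stuck 0<β (∈∁⁅⁆⁻ v∈ ∘ ≡.sym) x∉ v∉ t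
          (≡.subst (x ∈_) (≡.sym Bt≡⊤) ∈⊤)

    forcing⇒n∸1≤∣B∣ : 0# < β → IsTransmissionForcing α β (K n) B₀ → n ∸ 1 ℕ.≤ ∣ B₀ ∣
    forcing⇒n∸1≤∣B∣ 0<β forcing with any? (λ x → x ∈? ∁ B₀)
    ... | yes (x , x∈∁) = ≡.subst (ℕ._≤ _) (∣∁⁅x⁆∣≡n∸1 x)
                            (p⊆q⇒∣p∣≤∣q∣ (forcing⇒misses≤1 0<β forcing (x∈∁p⇒x∉p x∈∁)))
    ... | no  none      = ℕ.≤-trans (ℕ.m∸n≤m n 1)
                            (∀∈⇒n≤∣p∣ λ v → x∉∁p⇒x∈p (none ∘ (v ,_)))

    module _ {x} (x∉ : x ∉ B₀) (rest : ∁ ⁅ x ⁆ ⊆ B₀) where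

      𝒱₁≡∁⁅x⁆ : 𝒱 1 x ≡ ∁ ⁅ x ⁆
      𝒱₁≡∁⁅x⁆ = ⊆-antisym
        -- The projections extract the adjacency of `v` and `x`, which in `K n` is `v ≢ x`.
        -- Conversely, `∉⊥` holds because nothing is spent at time 0.
        (λ v∈𝒱 → ∈∁⁅⁆⁺ (proj₁ (proj₂ (proj₁ (proj₂ (∈𝒱⁻ 0 x v∈𝒱))))))
        (λ v∈ → ∈𝒱⁺ 0 x (rest v∈)
          (x∉ , ∈∁⁅⁆⁻ v∈ , λ u u∉ _ → decidable-stable (u ≟ x) (u∉ ∘ rest ∘ ∈∁⁅⁆⁺)) ∉⊥)

      w₁≈[n∸1]·α : w 1 x ≈ (n ∸ 1) · α
      w₁≈[n∸1]·α =
        trans (reflexive (w-unfilled 0 x∉))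
        (trans (+-cong (reflexive (w₀-unfilled x∉))
          (sum-over-const (𝒱 1 x) λ v v∈𝒱 →
            trans (*-congˡ (reflexive (w₀-filled (proj₁ (∈𝒱⁻ 0 x v∈𝒱)))))
                  (*-identityʳ α)))
        (trans (+-identityˡ _)
          (reflexive (≡.cong (_· α) (≡.trans (≡.cong ∣_∣ 𝒱₁≡∁⁅x⁆) (∣∁⁅x⁆∣≡n∸1 x))))))

      one-unfilled-forced : β ≤ (n ∸ 1) · α → IsTransmissionForcing α β (K n) B₀
      one-unfilled-forced β≤ = 1 , ⊆-antisym ⊆⊤ λ {v} _ → filled v
        where
        filled : ∀ v → v ∈ B 1
        filled v with v ≟ x
        ... | yes ≡.refl = ∈B-suc⁺ 0 x∉ (≤-respʳ-≈ (sym w₁≈[n∸1]·α) β≤)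
        ... | no  v≢x    = x∈p∪q⁺ (inj₁ (rest (∈∁⁅⁆⁺ v≢x)))

      one-unfilled-stuck : (n ∸ 1) · α < β → ∀ t → x ∉ B t
      one-unfilled-stuck short zero    = x∉
      one-unfilled-stuck short (suc t) = proj₁ (exhausted t)
        where
        -- This invariant begins at time 1, after the single round of transmissions; at time 0
        -- nothing is spent yet. Its last component is what rules out any later gain of weight.
        Exhausted : ℕ → Set _
        Exhausted t = x ∉ B t × w t x ≈ (n ∸ 1) · α × ∁ ⁅ x ⁆ ⊆ spent t

        too-light : ∀ {a} → a ≈ (n ∸ 1) · α → ¬ β ≤ a
        too-light a≈ = <⇒≱ antisym short ∘ ≤-respʳ-≈ a≈

        exhausted : ∀ t → Exhausted (suc t)
        exhausted zero =
          ∉B-suc 0 x∉ (too-light w₁≈[n∸1]·α) , w₁≈[n∸1]·α ,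
          λ {v} → 𝒱⊆spent 0 x ∘ ≡.subst (v ∈_) (≡.sym 𝒱₁≡∁⁅x⁆)
        exhausted (suc t) with exhausted t
        ... | x∉B , w≈ , rest-spent =
          ∉B-suc (suc t) x∉B (too-light w′≈) , w′≈ ,
          spent-mono (suc t) ∘ rest-spent
          where
          no-force : Empty (𝒱 (suc (suc t)) x)
          -- A sender is filled, hence not `x`, hence already spent.
          no-force (v , v∈𝒱) with ∈𝒱⁻ (suc t) x v∈𝒱
          ... | v∈B , _ , v∉spent = v∉spent (rest-spent (∈∁⁅⁆⁺ (∈∧∉⇒≢ v∈B x∉B)))

          w′≈ = trans (w-unforced (suc t) x∉B no-force) w≈

    -- A missed vertex would be the only one missed, and then the shortage of weight leaves it
    -- unfilled forever; so none is missed.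
    forcing⇒n≤∣B∣ : 0# < β → (n ∸ 1) · α < β → IsTransmissionForcing α β (K n) B₀ →
                    n ℕ.≤ ∣ B₀ ∣
    forcing⇒n≤∣B∣ 0<β short forcing@(t , Bt≡⊤) = ∀∈⇒n≤∣p∣ λ v →
      decidable-stable (v ∈? B₀) λ v∉ →
        one-unfilled-stuck v∉ (forcing⇒misses≤1 0<β forcing v∉) short t
          (≡.subst (v ∈_) (≡.sym Bt≡⊤) ∈⊤)

  -- The `Fin n` argument is the vertex left out of the optimal set; by symmetry any vertex serves.
  isZ-n∸1 : ∀ α β → Fin n → 0# < β → β ≤ (n ∸ 1) · α → IsZ α β (K n) (n ∸ 1)
  isZ-n∸1 α β x 0<β β≤ =
    (∁ ⁅ x ⁆ , one-unfilled-forced α β _ (x∈p⇒x∉∁p (x∈⁅x⁆ x)) id β≤ , ∣∁⁅x⁆∣≡n∸1 x) ,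
    λ B → forcing⇒n∸1≤∣B∣ α β B 0<β

  isZ-n : ∀ α β → 0# ≤ α → (n ∸ 1) · α < β → IsZ α β (K n) n
  isZ-n {n} α β 0≤α short =
    (⊤ , (0 , ≡.refl) , ∣⊤∣≡n n) , λ B → forcing⇒n≤∣B∣ α β B 0<β short
    where
    0<β = ≤-<-trans ≤-trans antisym ≤-respˡ-≈ (0≤n·x (n ∸ 1) 0≤α) short

-- The first case asks for `0# < β` because at `β ≈ 0#` even the empty set fills everything at time
-- 1, making the forcing number 0 instead of `n ∸ 1`. In the second case positivity of `β` follows
-- from `0# ≤ α`.
proposition4p1p1 : ∀ {c ℓ₁ ℓ₂} (R : OrderedField c ℓ₁ ℓ₂) →
    let open OrderedField R
        open Transmission R
    in
    ∀ (α β : Carrier) →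
    0# ≤ α → α ≤ 1# → 0# ≤ β → β ≤ 1# →
    ∀ (n : ℕ) → 2 ℕ.≤ n →
    (0# < β → β ≤ (n ∸ 1) · α → IsZ α β (K n) (n ∸ 1)) ×
    ((n ∸ 1) · α < β → IsZ α β (K n) n)
proposition4p1p1 R α β 0≤α _ _ _ (suc n) _ = isZ-n∸1 R α β zero , isZ-n R α β 0≤α
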